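{- For all integers $n\ge1$, the median Genocchi number $h_n$ is equal to the number of permutations $\sigma$ of $[2n]$ having only even-odd drops, i.e. permutations $\sigma$ such that for every $i\in[2n]$ with $i>\sigma(i)$, $i$ is even and $\sigma(i)$ is odd.
   Context: $[m]=\{1,\dots,m\}$. A Dumont derangement on $[2m]$ is a permutation $\sigma$ of $[2m]$ with $2i>\sigma(2i)$ and $2i-1<\sigma(2i-1)$ for all $i=1,\dots,m$. For $n\ge0$ the median Genocchi number $h_n$ is defined as the number of Dumont derangements on $[2n+2]$ (so $h_0,h_1,\ldots=1,2,8,56,608,\dots$). -}

module Defs where

open import Data.Fin.Base using (Fin; suc; toℕ; punchIn; combine; _<_; _>_)
open import Data.Fin.Patterns using (0F; 1F)
open import Data.Fin.Permutation using (Permutation′; _⟨$⟩ʳ_; _≈_; id; insert; remove;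
  insert-remove)
open import Data.Fin.Properties using (all?; _<?_; punchIn-injective; toℕ-combine)
open import Data.List.Base using (List; [_]; allFin; cartesianProductWith; filter; length)
open import Data.List.Membership.Setoid.Properties using (∈-cartesianProductWith⁺; ∈-resp-≈)
open import Data.List.Membership.Propositional.Properties using (∈-allFin)
open import Data.List.Relation.Unary.All using ([])
open import Data.List.Relation.Unary.AllPairs using ([]; _∷_)
open import Data.List.Relation.Unary.Any using (here)
open import Data.List.Relation.Unary.Enumerates.Setoid using (IsEnumeration)
open import Data.List.Relation.Unary.Unique.Setoid using (Unique)
open import Data.List.Relation.Unary.Unique.Setoid.Properties using (cartesianProductWith⁺)
open import Data.List.Relation.Unary.Unique.Propositional.Properties using (allFin⁺)
open import Data.Nat.Base using (ℕ; zero; suc; _+_; _*_; _∸_)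
open import Data.Nat.Divisibility using (_∣_; _∤_; _∣?_)
open import Data.Nat.Properties using (+-comm; +-identityʳ; *-suc)
open import Data.Product.Base using (_×_; _,_)
open import Level using (0ℓ)
open import Relation.Binary.Bundles using (Setoid)
open import Relation.Binary.PropositionalEquality
  using (_≡_; refl; sym; trans; cong; subst; setoid; module ≡-Reasoning)
open import Relation.Nullary.Decidable using (_×-dec_; _→-dec_; ¬?)
open import Relation.Binary.Definitions using (_Respects_)
open import Relation.Unary using (Pred; Decidable)

-- Fin m stands for [m] = {1,…,m}: j represents the integer value j = toℕ j + 1.
-- This shift preserves order, so _<_ and _>_ on Fin m are those of [m].
value : ∀ {m} → Fin m → ℕ
value j = suc (toℕ j)

-- The elements 2i − 1 and 2i of [2m]: see value-⟨2i-1⟩ and value-⟨2i⟩.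
⟨2_-1⟩ ⟨2_⟩ : ∀ {m} → Fin m → Fin (m * 2)
⟨2 i -1⟩ = combine i 0F
⟨2 i ⟩   = combine i 1F

value-⟨2i-1⟩ : ∀ {m} (i : Fin m) → value ⟨2 i -1⟩ ≡ 2 * value i ∸ 1
value-⟨2i-1⟩ i = begin
  suc (toℕ (combine i 0F))  ≡⟨ cong suc (toℕ-combine i 0F) ⟩
  suc (2 * toℕ i + 0)       ≡⟨ cong suc (+-identityʳ (2 * toℕ i)) ⟩
  suc (2 * toℕ i)           ≡⟨ cong (_∸ 1) (*-suc 2 (toℕ i)) ⟨
  2 * value i ∸ 1           ∎
  where open ≡-Reasoning

value-⟨2i⟩ : ∀ {m} (i : Fin m) → value ⟨2 i ⟩ ≡ 2 * value i
value-⟨2i⟩ i = begin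
  suc (toℕ (combine i 1F))  ≡⟨ cong suc (toℕ-combine i 1F) ⟩
  suc (2 * toℕ i + 1)       ≡⟨ cong suc (+-comm (2 * toℕ i) 1) ⟩
  2 + 2 * toℕ i             ≡⟨ *-suc 2 (toℕ i) ⟨
  2 * value i               ∎
  where open ≡-Reasoning

IsDumontDerangement : ∀ {m} → Pred (Permutation′ (m * 2)) 0ℓ
IsDumontDerangement {m} σ = (i : Fin m) →
  (⟨2 i ⟩ > σ ⟨$⟩ʳ ⟨2 i ⟩) × (⟨2 i -1⟩ < σ ⟨$⟩ʳ ⟨2 i -1⟩)

HasOnlyEvenOddDrops : ∀ {m} → Pred (Permutation′ m) 0ℓ
HasOnlyEvenOddDrops {m} σ = (i : Fin m) →
  i > σ ⟨$⟩ʳ i → (2 ∣ value i) × (2 ∤ value (σ ⟨$⟩ʳ i))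

-- Equal permutations are those with equal values, so both predicates are properties of the
-- permutation itself and not of its representation.
isDumontDerangement-resp : ∀ {m} → IsDumontDerangement {m} Respects _≈_
isDumontDerangement-resp π≈ρ d i with drop , rise ← d i =
  subst (⟨2 i ⟩ >_) (π≈ρ _) drop , subst (⟨2 i -1⟩ <_) (π≈ρ _) rise

hasOnlyEvenOddDrops-resp : ∀ {m} → HasOnlyEvenOddDrops {m} Respects _≈_
hasOnlyEvenOddDrops-resp π≈ρ d i i>ρi with even , odd ← d i (subst (i >_) (sym (π≈ρ i)) i>ρi) =
  even , subst (λ j → 2 ∤ value j) (π≈ρ i) odd

isDumontDerangement? : ∀ {m} → Decidable (IsDumontDerangement {m})
isDumontDerangement? σ = all? λ i →
  (σ ⟨$⟩ʳ ⟨2 i ⟩ <? ⟨2 i ⟩) ×-dec (⟨2 i -1⟩ <? σ ⟨$⟩ʳ ⟨2 i -1⟩)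

hasOnlyEvenOddDrops? : ∀ {m} → Decidable (HasOnlyEvenOddDrops {m})
hasOnlyEvenOddDrops? σ = all? λ i →
  (σ ⟨$⟩ʳ i <? i) →-dec ((2 ∣? value i) ×-dec ¬? (2 ∣? value (σ ⟨$⟩ʳ i)))

-- Choose the image j of the least element, then permute the rest.
allPermutations : ∀ m → List (Permutation′ m)
allPermutations zero    = [ id ]
allPermutations (suc m) = cartesianProductWith (insert 0F) (allFin (suc m)) (allPermutations m)

-- The number of permutations of [m] satisfying P. This is the true count for a P that depends
-- only on the values of σ, since allPermutations lists every permutation exactly once up to
-- pointwise equality (allPermutations-complete, allPermutations-unique).
count : ∀ {m} {P : Pred (Permutation′ m) 0ℓ} → Decidable P → ℕ
count {m} P? = length (filter P? (allPermutations m))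

-- suc n * 2 is 2n + 2.
medianGenocchi : ℕ → ℕ
medianGenocchi n = count (isDumontDerangement? {suc n})

PermutationSetoid : ℕ → Setoid 0ℓ 0ℓ
PermutationSetoid m = record
  { Carrier       = Permutation′ m
  ; _≈_           = _≈_
  ; isEquivalence = record
    { refl  = λ _ → refl
    ; sym   = λ p i → sym (p i)
    ; trans = λ p q i → trans (p i) (q i)
    }
  }

private
  insert-cong : ∀ {m} {j k : Fin (suc m)} {π ρ : Permutation′ m} → j ≡ k → π ≈ ρ → insert 0F j π ≈ insert 0F k ρ
  insert-cong refl π≈ρ 0F      = refl
  insert-cong {j = j} refl π≈ρ (suc i) = cong (punchIn j) (π≈ρ i)

  insert-injective : ∀ {m} {j k : Fin (suc m)} {π ρ : Permutation′ m} →
                     insert 0F j π ≈ insert 0F k ρ → j ≡ k × π ≈ ρ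
  insert-injective {j = j} {π = π} {ρ} eq with refl ← eq 0F =
    refl , λ i → punchIn-injective j (π ⟨$⟩ʳ i) (ρ ⟨$⟩ʳ i) (eq (suc i))

allPermutations-complete : ∀ m → IsEnumeration (PermutationSetoid m) (allPermutations m)
allPermutations-complete zero    π = here λ ()
allPermutations-complete (suc m) π =
  ∈-resp-≈ (PermutationSetoid (suc m)) {x = insert 0F (π ⟨$⟩ʳ 0F) (remove 0F π)} {π} (insert-remove 0F π)
    (∈-cartesianProductWith⁺ (setoid (Fin (suc m))) (PermutationSetoid m) (PermutationSetoid (suc m))
      (λ {j} {k} {π} {ρ} → insert-cong {π = π} {ρ})
      (∈-allFin (π ⟨$⟩ʳ 0F)) (allPermutations-complete m (remove 0F π)))

allPermutations-unique : ∀ m → Unique (PermutationSetoid m) (allPermutations m)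
allPermutations-unique zero    = [] ∷ []
allPermutations-unique (suc m) =
  cartesianProductWith⁺ (setoid (Fin (suc m))) (PermutationSetoid m) (PermutationSetoid (suc m))
    (insert 0F) (λ {j} {k} {π} {ρ} → insert-injective {π = π} {ρ})
    (allFin⁺ (suc m)) (allPermutations-unique m)

{-# OPTIONS --safe #-}
-- Both numbers are permanents of 0/1 matrices. Scan [N] upwards and remember only the number h of
-- positions (equivalently, of values) below the current element whose image (preimage) is yet to
-- come: each count becomes a weighted sum over lattice paths in h. For Dumont derangements the
-- steps are
--   odd element:  h → h + 1 (weight 1),   h → h (weight h),
--   even element: h → h ∸ 1 (weight h²),  h → h (weight h),
-- and for only even-odd drops they are
--   odd element:  h → h + 1 (weight 1),   h → h (weight h + 1),
--   even element: h → h ∸ 1 (weight h²),  h → h (weight h + 1).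
-- The first Dumont step is forced to be 0 → 1. From then on, reading the Dumont paths in pairs
-- (even, odd) and the others in pairs (odd, even), the weights from height h + 1 and from height h
-- agree up to the diagonal rescaling by h + 1.
module Submission where

open import Defs
open import Data.Bool.Base as Bool using (if_then_else_)
open import Data.Fin.Base as Fin using (Fin; toℕ; punchIn)
open import Data.Fin.Patterns using (0F; 1F)
open import Data.Fin.Permutation as Permutation using (Permutation′; _⟨$⟩ʳ_; insert)
open import Data.Fin.Properties using (combine-surjective; toℕ-combine)
open import Data.List.Base
  using (List; []; _∷_; _++_; map; replicate; iterate; tabulate; length; filter;
         cartesianProductWith)
open import Data.List.Properties
  using (++-identityʳ; tabulate-cong; length-++; filter-++; filter-none)
open import Data.List.Relation.Binary.Permutation.Propositional
  using (_↭_; refl; prep; swap; trans)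
open import Data.List.Relation.Binary.Permutation.Propositional.Properties using (shift)
open import Data.List.Relation.Unary.All as All using (All; []; _∷_)
open import Data.Maybe.Base using (Maybe; just; nothing)
open import Data.Nat.Base using (ℕ; zero; suc; pred; _+_; _*_; _≤_; _<_; _≥_)
open import Data.Nat.Divisibility
  using (_∣_; _∤_; _∣?_; m∣m*n; _∣0; ∣m+n∣m⇒∣n; ∣m∣n⇒∣m+n; ∣-refl; ∣1⇒≡1)
open import Data.Nat.ListAction using (sum)
open import Data.Nat.Properties
open import Data.Nat.Tactic.RingSolver using (solve-∀)
open import Data.Product.Base using (_×_; _,_; proj₁; proj₂)
open import Function.Base using (_∘_; flip; id)
open import Function.Bundles using (_⇔_; mk⇔; Equivalence)
open import Level using (0ℓ)
open import Relation.Binary.PropositionalEquality as ≡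
  using (_≡_; _≗_; refl; sym; cong; cong₂; subst; module ≡-Reasoning)
open import Relation.Nullary.Decidable
  using (Dec; does; yes; no; dec-true; dec-false; does-⇔; decidable-stable; _×-dec_; _→-dec_; ¬?)
open import Relation.Nullary.Negation using (¬_; contradiction)
open import Relation.Unary using (Pred; Decidable)
open ≡-Reasoning

private variable
  A B : Set

-- Sums over a selected element and the remaining list

sumSel : (A → List A → ℕ) → List A → ℕ
sumSel g []       = 0
sumSel g (x ∷ xs) = g x xs + sumSel (λ y ys → g y (x ∷ ys)) xs

sumSel-congᴬ : {P : A → Set} {f g : A → List A → ℕ} → (∀ x xs → P x → f x xs ≡ g x xs) →
               ∀ {xs} → All P xs → sumSel f xs ≡ sumSel g xs
sumSel-congᴬ f≗g []         = refl
sumSel-congᴬ f≗g (px ∷ pxs) =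
  cong₂ _+_ (f≗g _ _ px) (sumSel-congᴬ (λ y ys → f≗g y (_ ∷ ys)) pxs)

sumSel-cong : {f g : A → List A → ℕ} → (∀ x xs → f x xs ≡ g x xs) → sumSel f ≗ sumSel g
sumSel-cong f≗g []       = refl
sumSel-cong f≗g (x ∷ xs) = cong₂ _+_ (f≗g x xs) (sumSel-cong (λ y ys → f≗g y (x ∷ ys)) xs)

sumSel-zero : (xs : List A) → sumSel (λ _ _ → 0) xs ≡ 0
sumSel-zero []       = refl
sumSel-zero (x ∷ xs) = sumSel-zero xs

sumSel-+ : (f g : A → List A → ℕ) → ∀ xs →
           sumSel (λ x xs′ → f x xs′ + g x xs′) xs ≡ sumSel f xs + sumSel g xs
sumSel-+ f g []       = refl
sumSel-+ f g (x ∷ xs) = begin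
  f x xs + g x xs + sumSel (λ y ys → f y (x ∷ ys) + g y (x ∷ ys)) xs
    ≡⟨ cong (f x xs + g x xs +_) (sumSel-+ (λ y ys → f y (x ∷ ys)) (λ y ys → g y (x ∷ ys)) xs) ⟩
  f x xs + g x xs + (F + G)
    ≡⟨ +-exchange (f x xs) (g x xs) F G ⟩
  f x xs + F + (g x xs + G) ∎
  where
  F = sumSel (λ y ys → f y (x ∷ ys)) xs
  G = sumSel (λ y ys → g y (x ∷ ys)) xs
  +-exchange : ∀ a b c d → a + b + (c + d) ≡ a + c + (b + d)
  +-exchange = solve-∀

sumSel-* : ∀ k (f : A → List A → ℕ) xs → sumSel (λ x xs′ → k * f x xs′) xs ≡ k * sumSel f xs
sumSel-* k f []       = sym (*-zeroʳ k)
sumSel-* k f (x ∷ xs) = begin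
  k * f x xs + sumSel (λ y ys → k * f y (x ∷ ys)) xs
    ≡⟨ cong (k * f x xs +_) (sumSel-* k (λ y ys → f y (x ∷ ys)) xs) ⟩
  k * f x xs + k * sumSel (λ y ys → f y (x ∷ ys)) xs
    ≡⟨ *-distribˡ-+ k _ _ ⟨
  k * sumSel f (x ∷ xs) ∎

sumSel-comm : (g : A → List A → B → List B → ℕ) → ∀ xs ys →
              sumSel (λ x xs′ → sumSel (g x xs′) ys) xs ≡
              sumSel (λ y ys′ → sumSel (λ x xs′ → g x xs′ y ys′) xs) ys
sumSel-comm g []       ys = sym (sumSel-zero ys)
sumSel-comm g (x ∷ xs) ys = begin
  sumSel (g x xs) ys + sumSel (λ x′ xs′ → sumSel (g x′ (x ∷ xs′)) ys) xs
    ≡⟨ cong (sumSel (g x xs) ys +_) (sumSel-comm (λ x′ xs′ → g x′ (x ∷ xs′)) xs ys) ⟩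
  sumSel (g x xs) ys + sumSel (λ y ys′ → sumSel (λ x′ xs′ → g x′ (x ∷ xs′) y ys′) xs) ys
    ≡⟨ sumSel-+ (g x xs) _ ys ⟨
  sumSel (λ y ys′ → sumSel (λ x′ xs′ → g x′ xs′ y ys′) (x ∷ xs)) ys ∎

-- The list left over does not depend on which of two entries is removed first. On the left the head
-- is chosen first (`F`), second (`G`) or not at all (`H`, by induction).
sumSel-swap : (g : A → A → List A → ℕ) → ∀ xs →
              sumSel (λ x → sumSel (λ y → g x y)) xs ≡ sumSel (λ x → sumSel (λ y → g y x)) xs
sumSel-swap g []       = refl
sumSel-swap g (x ∷ xs) = begin
  F + sumSel (λ y ys → g y x ys + sumSel (λ z zs → g y z (x ∷ zs)) ys) xs
    ≡⟨ cong (F +_) (sumSel-+ (λ y → g y x) (λ y → sumSel (λ z zs → g y z (x ∷ zs))) xs) ⟩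
  F + (G + sumSel (λ y → sumSel (λ z zs → g y z (x ∷ zs))) xs)
    ≡⟨ cong (λ s → F + (G + s)) (sumSel-swap (λ y z zs → g y z (x ∷ zs)) xs) ⟩
  F + (G + H)
    ≡⟨ +-comm-middle F G H ⟩
  G + (F + H)
    ≡⟨ cong (G +_) (sumSel-+ (g x) (λ y → sumSel (λ z zs → g z y (x ∷ zs))) xs) ⟨
  G + sumSel (λ y ys → g x y ys + sumSel (λ z zs → g z y (x ∷ zs)) ys) xs ∎
  where
  F = sumSel (g x) xs
  G = sumSel (λ y → g y x) xs
  H = sumSel (λ y → sumSel (λ z zs → g z y (x ∷ zs))) xs
  +-comm-middle : ∀ a b c → a + (b + c) ≡ b + (a + c)
  +-comm-middle = solve-∀

sumSel-++ : (g : A → List A → ℕ) → ∀ xs ys →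
            sumSel g (xs ++ ys) ≡
            sumSel (λ x xs′ → g x (xs′ ++ ys)) xs + sumSel (λ y ys′ → g y (xs ++ ys′)) ys
sumSel-++ g []       ys = refl
sumSel-++ g (x ∷ xs) ys = begin
  g x (xs ++ ys) + sumSel (λ y zs → g y (x ∷ zs)) (xs ++ ys)
    ≡⟨ cong (g x (xs ++ ys) +_) (sumSel-++ (λ y zs → g y (x ∷ zs)) xs ys) ⟩
  g x (xs ++ ys) + (F + G)
    ≡⟨ +-assoc (g x (xs ++ ys)) F G ⟨
  g x (xs ++ ys) + F + G ∎
  where
  F = sumSel (λ y zs → g y (x ∷ zs ++ ys)) xs
  G = sumSel (λ y zs → g y (x ∷ xs ++ zs)) ys

sumSel-replicate : (g : A → List A → ℕ) → ∀ n x →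
                   sumSel g (replicate n x) ≡ n * g x (replicate (pred n) x)
sumSel-replicate g zero          x = refl
sumSel-replicate g (suc zero)    x = refl
sumSel-replicate g (suc (suc n)) x =
  cong (g x (replicate (suc n) x) +_) (sumSel-replicate (λ y ys → g y (x ∷ ys)) (suc n) x)

-- `punchIn j` lists the indices other than `j` in order, just as `insert 0F j` relabels the
-- remaining values.
sumSel-tabulate : (g : A → List A → ℕ) → ∀ {n} (f : Fin (suc n) → A) →
                  sumSel g (tabulate f) ≡ sum (tabulate λ j → g (f j) (tabulate (f ∘ punchIn j)))
sumSel-tabulate g {zero}  f = refl
sumSel-tabulate g {suc n} f = cong (g (f 0F) (tabulate (f ∘ Fin.suc)) +_)
  (sumSel-tabulate (λ x xs → g x (f 0F ∷ xs)) (f ∘ Fin.suc))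

-- Permanents

private
  *-comm-middle : ∀ x y z → x * (y * z) ≡ y * (x * z)
  *-comm-middle = solve-∀

-- Laplace expansion along the first row; lists of unequal length give 0.
perm : (A → B → ℕ) → List A → List B → ℕ
perm w []       []      = 1
perm w []       (_ ∷ _) = 0
perm w (a ∷ as) bs      = sumSel (λ b bs′ → w a b * perm w as bs′) bs

-- Either the first row takes column `b`, or induction expands its minor along `b` and the choices
-- of a column and of a row commute.
perm-column : (w : A → B → ℕ) → ∀ as b bs →
              perm w as (b ∷ bs) ≡ sumSel (λ a as′ → w a b * perm w as′ bs) as
perm-column w []       b bs = refl
perm-column w (a ∷ as) b bs = cong (w a b * perm w as bs +_) (begin
  sumSel (λ b′ bs′ → w a b′ * perm w as (b ∷ bs′)) bs
    ≡⟨ sumSel-cong (λ b′ bs′ → cong (w a b′ *_) (perm-column w as b bs′)) bs ⟩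
  sumSel (λ b′ bs′ → w a b′ * sumSel (λ a′ as′ → w a′ b * perm w as′ bs′) as) bs
    ≡⟨ sumSel-cong (λ b′ bs′ → sumSel-* (w a b′) _ as) bs ⟨
  sumSel (λ b′ bs′ → sumSel (λ a′ as′ → w a b′ * (w a′ b * perm w as′ bs′)) as) bs
    ≡⟨ sumSel-comm (λ b′ bs′ a′ as′ → w a b′ * (w a′ b * perm w as′ bs′)) bs as ⟩
  sumSel (λ a′ as′ → sumSel (λ b′ bs′ → w a b′ * (w a′ b * perm w as′ bs′)) bs) as
    ≡⟨ sumSel-cong (λ a′ as′ → sumSel-cong (λ b′ bs′ →
         *-comm-middle (w a b′) (w a′ b) (perm w as′ bs′)) bs) as ⟩
  sumSel (λ a′ as′ → sumSel (λ b′ bs′ → w a′ b * (w a b′ * perm w as′ bs′)) bs) as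
    ≡⟨ sumSel-cong (λ a′ as′ → sumSel-* (w a′ b) _ bs) as ⟩
  sumSel (λ a′ as′ → w a′ b * perm w (a ∷ as′) bs) as ∎)

perm-transpose : (w : A → B → ℕ) → ∀ as bs → perm w as bs ≡ perm (flip w) bs as
perm-transpose w []       []       = refl
perm-transpose w []       (b ∷ bs) = refl
perm-transpose w (a ∷ as) bs       = begin
  sumSel (λ b bs′ → w a b * perm w as bs′) bs
    ≡⟨ sumSel-cong (λ b bs′ → cong (w a b *_) (perm-transpose w as bs′)) bs ⟩
  sumSel (λ b bs′ → w a b * perm (flip w) bs′ as) bs
    ≡⟨ perm-column (flip w) bs a as ⟨
  perm (flip w) bs (a ∷ as) ∎

-- Only `swap` has content: expanding two rows chooses an ordered pair of columns, which
-- `sumSel-swap` reverses.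
perm-↭ˡ : (w : A → B → ℕ) → ∀ {as as′} → as ↭ as′ → perm w as ≗ perm w as′
perm-↭ˡ w refl        bs = refl
perm-↭ˡ w (prep a p)  bs = sumSel-cong (λ b bs′ → cong (w a b *_) (perm-↭ˡ w p bs′)) bs
perm-↭ˡ w (trans p q) bs = ≡.trans (perm-↭ˡ w p bs) (perm-↭ˡ w q bs)
perm-↭ˡ w (swap {as} {as′} a a′ p) bs = begin
  sumSel (λ b bs′ → w a b * sumSel (λ b′ bs″ → w a′ b′ * perm w as bs″) bs′) bs
    ≡⟨ sumSel-cong (λ b bs′ → sumSel-* (w a b) _ bs′) bs ⟨
  sumSel (λ b bs′ → sumSel (λ b′ bs″ → w a b * (w a′ b′ * perm w as bs″)) bs′) bs
    ≡⟨ sumSel-swap (λ b b′ bs″ → w a b * (w a′ b′ * perm w as bs″)) bs ⟩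
  sumSel (λ b bs′ → sumSel (λ b′ bs″ → w a b′ * (w a′ b * perm w as bs″)) bs′) bs
    ≡⟨ sumSel-cong (λ b bs′ → sumSel-cong (λ b′ bs″ → begin
         w a b′ * (w a′ b * perm w as bs″)
           ≡⟨ *-comm-middle (w a b′) (w a′ b) (perm w as bs″) ⟩
         w a′ b * (w a b′ * perm w as bs″)
           ≡⟨ cong (λ x → w a′ b * (w a b′ * x)) (perm-↭ˡ w p bs″) ⟩
         w a′ b * (w a b′ * perm w as′ bs″) ∎) bs′) bs ⟩
  sumSel (λ b bs′ → sumSel (λ b′ bs″ → w a′ b * (w a b′ * perm w as′ bs″)) bs′) bs
    ≡⟨ sumSel-cong (λ b bs′ → sumSel-* (w a′ b) _ bs′) bs ⟩
  sumSel (λ b bs′ → w a′ b * sumSel (λ b′ bs″ → w a b′ * perm w as′ bs″) bs′) bs ∎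

perm-↭ʳ : (w : A → B → ℕ) → ∀ as {bs bs′} → bs ↭ bs′ → perm w as bs ≡ perm w as bs′
perm-↭ʳ w as {bs} {bs′} p = begin
  perm w as bs          ≡⟨ perm-transpose w as bs ⟩
  perm (flip w) bs as   ≡⟨ perm-↭ˡ (flip w) p as ⟩
  perm (flip w) bs′ as  ≡⟨ perm-transpose w as bs′ ⟨
  perm w as bs′         ∎

-- A matrix with h identical rows o and h identical columns o′, in which the row r and the column c
-- are, up to the factors γ and ε, like o and o′ on the remaining columns and rows.

module _ (w : A → B → ℕ) {o : A} {o′ : B} (w-oo′ : w o o′ ≡ 0) where

  -- Linearity in the first row: as `o` vanishes on the columns `o′`, row `r` is `γ` times row `o`
  -- plus a row that is `α` on the columns `o′` and 0 on `C`.
  perm-row : ∀ {r α} γ as h {C} → w r o′ ≡ α → All (λ b → w r b ≡ γ * w o b) C →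
             perm w (r ∷ as) (replicate h o′ ++ C) ≡
             α * (h * perm w as (replicate (pred h) o′ ++ C)) +
             γ * perm w (o ∷ as) (replicate h o′ ++ C)
  perm-row {r} {α} γ as h {C} refl r~o = begin
    perm w (r ∷ as) (replicate h o′ ++ C)
      ≡⟨ expand r ⟩
    h * (α * V) + sumSel (λ b bs → w r b * perm w as (replicate h o′ ++ bs)) C
      ≡⟨ cong (h * (α * V) +_) (sumSel-congᴬ (λ b bs eq →
           ≡.trans (cong (_* perm w as (replicate h o′ ++ bs)) eq)
                   (*-assoc γ (w o b) (perm w as (replicate h o′ ++ bs)))) r~o) ⟩
    h * (α * V) + sumSel (λ b bs → γ * (w o b * perm w as (replicate h o′ ++ bs))) C
      ≡⟨ cong (h * (α * V) +_) (sumSel-* γ _ C) ⟩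
    h * (α * V) + γ * S
      ≡⟨ rearrange h α γ V S ⟩
    α * (h * V) + γ * (h * (0 * V) + S)
      ≡⟨ cong (λ x → α * (h * V) + γ * (h * (x * V) + S)) w-oo′ ⟨
    α * (h * V) + γ * (h * (w o o′ * V) + S)
      ≡⟨ cong (λ x → α * (h * V) + γ * x) (expand o) ⟨
    α * (h * V) + γ * perm w (o ∷ as) (replicate h o′ ++ C) ∎
    where
    V = perm w as (replicate (pred h) o′ ++ C)
    S = sumSel (λ b bs → w o b * perm w as (replicate h o′ ++ bs)) C
    expand : ∀ a → perm w (a ∷ as) (replicate h o′ ++ C) ≡
                   h * (w a o′ * V) + sumSel (λ b bs → w a b * perm w as (replicate h o′ ++ bs)) C
    expand a = ≡.trans (sumSel-++ _ (replicate h o′) C)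
      (cong (_+ sumSel (λ b bs → w a b * perm w as (replicate h o′ ++ bs)) C)
        (sumSel-replicate (λ b bs → w a b * perm w as (bs ++ C)) h o′))
    rearrange : ∀ h α γ v s → h * (α * v) + γ * s ≡ α * (h * v) + γ * (h * (0 * v) + s)
    rearrange = solve-∀

  -- Expansion along column `c`, which meets row `r` (`β`), one of the `h` rows `o`, or a row of
  -- `R`; in the last case `c` acts, up to `ε`, as one more column `o′`. If row `r` is left, it
  -- takes a column `o′` (`α`) or acts, up to `γ`, as one more row `o`.
  perm-step : ∀ {r c α β R C} γ ε h →
    w r o′ ≡ α → w r c ≡ β → w o c ≡ 1 →
    All (λ b → w r b ≡ γ * w o b) C → All (λ a → w a c ≡ ε * w a o′) R →
    let V = λ k → perm w (replicate k o ++ R) (replicate k o′ ++ C) in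
    perm w (replicate h o ++ r ∷ R) (replicate h o′ ++ c ∷ C) ≡
    h * (α * (h * V (pred h)) + γ * V h) + β * V h + ε * (α * (h * V h) + γ * V (suc h))
  perm-step {r} {c} {α} {β} {R} {C} γ ε h w-ro′ w-rc w-oc r~o c~o′ = begin
    perm w (replicate h o ++ r ∷ R) (replicate h o′ ++ c ∷ C)
      ≡⟨ perm-↭ˡ w (shift r (replicate h o) R) _ ⟩
    perm w (r ∷ replicate h o ++ R) (replicate h o′ ++ c ∷ C)
      ≡⟨ perm-↭ʳ w (r ∷ replicate h o ++ R) (shift c (replicate h o′) C) ⟩
    perm w (r ∷ replicate h o ++ R) (c ∷ replicate h o′ ++ C)
      ≡⟨ column c (replicate h o′ ++ C) ⟩
    w r c * V h + (h * (w o c * X) + sumSel (λ a as → w a c * Y as) R)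
      ≡⟨ cong₂ (λ x y → x * V h + (h * (y * X) + sumSel (λ a as → w a c * Y as) R)) w-rc w-oc ⟩
    β * V h + (h * (1 * X) + sumSel (λ a as → w a c * Y as) R)
      ≡⟨ cong (λ x → β * V h + (h * (1 * X) + x)) (sumSel-congᴬ (λ a as eq →
           ≡.trans (cong (_* Y as) eq) (*-assoc ε (w a o′) (Y as))) c~o′) ⟩
    β * V h + (h * (1 * X) + sumSel (λ a as → ε * (w a o′ * Y as)) R)
      ≡⟨ cong (λ x → β * V h + (h * (1 * X) + x)) (sumSel-* ε _ R) ⟩
    β * V h + (h * (1 * X) + ε * T)
      ≡⟨ rearrange (β * V h) h X (ε * T) ⟩
    h * X + β * V h + ε * T
      ≡⟨ cong₂ (λ x t → x + β * V h + ε * t) (X-expand h) T-expand ⟩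
    h * (α * (h * V (pred h)) + γ * V h) + β * V h + ε * (α * (h * V h) + γ * V (suc h)) ∎
    where
    V = λ k → perm w (replicate k o ++ R) (replicate k o′ ++ C)
    X = perm w (r ∷ replicate (pred h) o ++ R) (replicate h o′ ++ C)
    Y = λ as → perm w (r ∷ replicate h o ++ as) (replicate h o′ ++ C)
    T = sumSel (λ a as → w a o′ * Y as) R

    rearrange : ∀ a h x t → a + (h * (1 * x) + t) ≡ h * x + a + t
    rearrange = solve-∀

    column : ∀ b bs → perm w (r ∷ replicate h o ++ R) (b ∷ bs) ≡
      w r b * perm w (replicate h o ++ R) bs +
      (h * (w o b * perm w (r ∷ replicate (pred h) o ++ R) bs) +
       sumSel (λ a as → w a b * perm w (r ∷ replicate h o ++ as) bs) R)
    column b bs = ≡.trans (perm-column w (r ∷ replicate h o ++ R) b bs)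
      (cong (w r b * perm w (replicate h o ++ R) bs +_)
        (≡.trans (sumSel-++ (λ a as → w a b * perm w (r ∷ as) bs) (replicate h o) R)
          (cong (_+ sumSel (λ a as → w a b * perm w (r ∷ replicate h o ++ as) bs) R)
            (sumSel-replicate (λ a as → w a b * perm w (r ∷ as ++ R) bs) h o))))

    X-expand : ∀ h → h * perm w (r ∷ replicate (pred h) o ++ R) (replicate h o′ ++ C) ≡
                     h * (α * (h * V (pred h)) + γ * V h)
    X-expand zero    = refl
    X-expand (suc h) = cong (suc h *_) (perm-row γ (replicate h o ++ R) (suc h) w-ro′ r~o)

    T-expand : T ≡ α * (h * V h) + γ * V (suc h)
    -- `T` is part of the expansion along `o′` of a permanent with `h + 1` columns `o′`. Evaluating
    -- it by column and by row, one summand `α * V h` cancels.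
    T-expand = +-cancelˡ-≡ (α * V h) _ _ (begin
      α * V h + T
        ≡⟨ cong (λ x → α * V h + (x + T)) (*-zeroʳ h) ⟨
      α * V h + (h * 0 + T)
        ≡⟨ cong₂ (λ x y → x * V h + (h * (y * Z) + T)) w-ro′ w-oo′ ⟨
      w r o′ * V h + (h * (w o o′ * Z) + T)
        ≡⟨ column o′ (replicate h o′ ++ C) ⟨
      perm w (r ∷ replicate h o ++ R) (replicate (suc h) o′ ++ C)
        ≡⟨ perm-row γ (replicate h o ++ R) (suc h) w-ro′ r~o ⟩
      α * (suc h * V h) + γ * V (suc h)
        ≡⟨ split-suc α h (V h) (γ * V (suc h)) ⟩
      α * V h + (α * (h * V h) + γ * V (suc h)) ∎)
      where
      Z = perm w (r ∷ replicate (pred h) o ++ R) (replicate h o′ ++ C)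
      split-suc : ∀ α h v x → α * ((1 + h) * v) + x ≡ α * v + (α * (h * v) + x)
      split-suc = solve-∀

-- Counting permutations by permanents

𝟙 : {P : Set} → Dec P → ℕ
𝟙 P? = if does P? then 1 else 0

𝟙-true : {P : Set} (P? : Dec P) → P → 𝟙 P? ≡ 1
𝟙-true P? p = cong (if_then 1 else 0) (dec-true P? p)

𝟙-false : {P : Set} (P? : Dec P) → ¬ P → 𝟙 P? ≡ 0
𝟙-false P? ¬p = cong (if_then 1 else 0) (dec-false P? ¬p)

𝟙-⇔ : {P Q : Set} (P? : Dec P) (Q? : Dec Q) → P ⇔ Q → 𝟙 P? ≡ 𝟙 Q?
𝟙-⇔ P? Q? P⇔Q = cong (if_then 1 else 0) (does-⇔ P⇔Q P? Q?)

length-filter-map : {P : Pred B 0ℓ} (P? : Decidable P) (f : A → B) → ∀ xs →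
                    length (filter P? (map f xs)) ≡ length (filter (P? ∘ f) xs)
length-filter-map P? f []       = refl
length-filter-map P? f (x ∷ xs) with does (P? (f x))
... | Bool.true  = cong suc (length-filter-map P? f xs)
... | Bool.false = length-filter-map P? f xs

length-filter-cartesianProductWith :
  {C : Set} {P : Pred C 0ℓ} (P? : Decidable P) (f : A → B → C) → ∀ {n} (g : Fin n → A) ys →
  length (filter P? (cartesianProductWith f (tabulate g) ys)) ≡
  sum (tabulate λ i → length (filter (P? ∘ f (g i)) ys))
length-filter-cartesianProductWith P? f {zero}  g ys = refl
length-filter-cartesianProductWith P? f {suc n} g ys = begin
  length (filter P? (map (f (g 0F)) ys ++ cartesianProductWith f (tabulate (g ∘ Fin.suc)) ys))
    ≡⟨ cong length (filter-++ P? (map (f (g 0F)) ys) _) ⟩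
  length (filter P? (map (f (g 0F)) ys) ++ _)
    ≡⟨ length-++ (filter P? (map (f (g 0F)) ys)) ⟩
  length (filter P? (map (f (g 0F)) ys)) +
  length (filter P? (cartesianProductWith f (tabulate (g ∘ Fin.suc)) ys))
    ≡⟨ cong₂ _+_ (length-filter-map P? (f (g 0F)) ys)
                 (length-filter-cartesianProductWith P? f (g ∘ Fin.suc) ys) ⟩
  sum (tabulate λ i → length (filter (P? ∘ f (g i)) ys)) ∎

-- Induction along `allPermutations`: the image `j` of `0F` is the column chosen in the first row,
-- and the rest is counted by the minor. Arbitrary labellings `f`, `g` make the minor an instance of
-- the same statement.
count-perm : ∀ {m} {P : Pred (Permutation′ m) 0ℓ} (P? : Decidable P)
  {R : Fin m → Fin m → Set} (R? : ∀ i j → Dec (R i j)) →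
  (∀ σ → P σ ⇔ (∀ i → R i (σ ⟨$⟩ʳ i))) →
  (w : A → B → ℕ) (f : Fin m → A) (g : Fin m → B) → (∀ i j → w (f i) (g j) ≡ 𝟙 (R? i j)) →
  count P? ≡ perm w (tabulate f) (tabulate g)
count-perm {m = zero}  P? R? P⇔R w f g w≡𝟙 with P? Permutation.id
... | yes _ = refl
... | no ¬p = contradiction (Equivalence.from (P⇔R _) λ ()) ¬p
count-perm {m = suc m} {P} P? {R} R? P⇔R w f g w≡𝟙 = begin
  count P?
    ≡⟨ length-filter-cartesianProductWith P? (insert 0F) id (allPermutations m) ⟩
  sum (tabulate λ j → count (P? ∘ insert 0F j))
    ≡⟨ cong sum (tabulate-cong image) ⟩
  sum (tabulate λ j → w (f 0F) (g j) * perm w (tabulate (f ∘ Fin.suc)) (tabulate (g ∘ punchIn j)))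
    ≡⟨ sumSel-tabulate (λ b bs → w (f 0F) b * perm w (tabulate (f ∘ Fin.suc)) bs) g ⟨
  perm w (tabulate f) (tabulate g) ∎
  where
  image : ∀ j → count (P? ∘ insert 0F j) ≡
    w (f 0F) (g j) * perm w (tabulate (f ∘ Fin.suc)) (tabulate (g ∘ punchIn j))
  image j rewrite w≡𝟙 0F j with R? 0F j
  ... | yes r = ≡.trans
    (count-perm (P? ∘ insert 0F j) (λ i k → R? (Fin.suc i) (punchIn j k))
      (λ σ → mk⇔ (λ p i → Equivalence.to (P⇔R (insert 0F j σ)) p (Fin.suc i))
                 (λ q → Equivalence.from (P⇔R (insert 0F j σ)) λ where
                   0F          → r
                   (Fin.suc i) → q i))
      w (f ∘ Fin.suc) (g ∘ punchIn j) (λ i k → w≡𝟙 (Fin.suc i) (punchIn j k)))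
    (sym (+-identityʳ _))
  -- A zero entry: no permutation sending `0F` to `j` passes the filter.
  ... | no ¬r = cong length (filter-none (P? ∘ insert 0F j)
    (All.universal (λ σ p → ¬r (Equivalence.to (P⇔R (insert 0F j σ)) p 0F)) (allPermutations m)))

-- The matrices of the two counting problems

labels : ℕ → ℕ → List (Maybe ℕ)
labels k n = map just (iterate suc k n)

tabulate-labels : ∀ k n → tabulate {n = n} (λ i → just (toℕ i + k)) ≡ labels k n
tabulate-labels k zero    = refl
tabulate-labels k (suc n) = cong (just k ∷_) (≡.trans
  (tabulate-cong λ i → cong just (sym (+-suc (toℕ i) k))) (tabulate-labels (suc k) n))

labels-< : ∀ {P : Pred (Maybe ℕ) 0ℓ} k l n → k < l → (∀ i → k < i → P (just i)) →
           All P (labels l n)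
labels-< k l zero    k<l p = []
labels-< k l (suc n) k<l p = p l k<l ∷ labels-< k (suc l) n (m<n⇒m<1+n k<l) p

module Scan {R : ℕ → ℕ → Set} (R? : ∀ i j → Dec (R i j)) where

  -- just i is the element i + 1 of [N]; nothing is a position or a value below the current element
  -- that is still unmatched. In both problems every future value may go to an unmatched position,
  -- but an unmatched value is available to the even future positions only.
  weight : Maybe ℕ → Maybe ℕ → ℕ
  weight nothing  nothing  = 0
  weight nothing  (just j) = 1
  weight (just i) nothing  = 𝟙 (2 ∣? suc i)
  weight (just i) (just j) = 𝟙 (R? i j)

  -- The count that remains with `n` elements from `k` on still to scan. Equally many positions and
  -- values have been scanned and matched, so one `h` serves for both.
  W : (k n h : ℕ) → ℕ
  W k n h = perm weight (replicate h nothing ++ labels k n) (replicate h nothing ++ labels k n)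

  W-unmatched : ∀ k h → W k 0 (suc h) ≡ 0
  W-unmatched k h rewrite ++-identityʳ (replicate h (nothing {A = ℕ})) = begin
    sumSel (λ b bs → weight nothing b * perm weight (replicate h nothing) bs)
           (replicate (suc h) nothing)
      ≡⟨ sumSel-replicate (λ b bs → weight nothing b * perm weight (replicate h nothing) bs)
                          (suc h) nothing ⟩
    suc h * 0
      ≡⟨ *-zeroʳ h ⟩
    0 ∎

  -- The coefficients say what is allowed: the position takes a smaller unmatched value (`α`), the
  -- element is fixed (`β`), the position waits for a larger value (`γ`), the value waits for a
  -- larger even position (`ε`).
  W-step : ∀ {k α β} γ ε → 𝟙 (2 ∣? suc k) ≡ α → 𝟙 (R? k k) ≡ β →
    (∀ j → k < j → 𝟙 (R? k j) ≡ γ) → (∀ i → k < i → 𝟙 (R? i k) ≡ ε * 𝟙 (2 ∣? suc i)) →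
    ∀ n h → let V = W (suc k) n in
    W k (suc n) h ≡
    h * (α * (h * V (pred h)) + γ * V h) + β * V h + ε * (α * (h * V h) + γ * V (suc h))
  W-step {k} γ ε drop fix rise fall n h = perm-step weight refl γ ε h drop fix refl
    (labels-< k (suc k) n (n<1+n k) λ j k<j → ≡.trans (rise j k<j) (sym (*-identityʳ γ)))
    (labels-< k (suc k) n (n<1+n k) fall)

  count-W : ∀ {m} {P : Pred (Permutation′ m) 0ℓ} (P? : Decidable P) →
    (∀ σ → P σ ⇔ (∀ i → R (toℕ i) (toℕ (σ ⟨$⟩ʳ i)))) → count P? ≡ W 0 m 0
  count-W {m} P? P⇔R = begin
    count P?
      ≡⟨ count-perm P? (λ i j → R? (toℕ i) (toℕ j)) P⇔R weight _ _ (λ i j → refl) ⟩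
    perm weight (tabulate label) (tabulate label)
      ≡⟨ cong₂ (perm weight) tabulate-label tabulate-label ⟩
    W 0 m 0 ∎
    where
    label : Fin m → Maybe ℕ
    label i = just (toℕ i)
    tabulate-label : tabulate label ≡ labels 0 m
    tabulate-label = ≡.trans
      (tabulate-cong λ i → cong just (sym (+-identityʳ (toℕ i)))) (tabulate-labels 0 m)

-- Admissible entries and the step weights of the two scans

2∣n⇒2∤1+n : ∀ {n} → 2 ∣ n → 2 ∤ suc n
2∣n⇒2∤1+n {n} 2∣n 2∣1+n with () ← ∣1⇒≡1 (∣m+n∣m⇒∣n (subst (2 ∣_) (+-comm 1 n) 2∣1+n) 2∣n)

2∣n⇒2∣2+n : ∀ {n} → 2 ∣ n → 2 ∣ 2 + n
2∣n⇒2∣2+n = ∣m∣n⇒∣m+n ∣-refl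

DumontCell EvenOddDropCell : ℕ → ℕ → Set
DumontCell      i j = (2 ∣ suc i → j < i) × (2 ∤ suc i → i < j)
EvenOddDropCell i j = j < i → (2 ∣ suc i) × (2 ∤ suc j)

dumontCell? : ∀ i j → Dec (DumontCell i j)
dumontCell? i j = ((2 ∣? suc i) →-dec (j <? i)) ×-dec (¬? (2 ∣? suc i) →-dec (i <? j))

evenOddDropCell? : ∀ i j → Dec (EvenOddDropCell i j)
evenOddDropCell? i j = (j <? i) →-dec ((2 ∣? suc i) ×-dec ¬? (2 ∣? suc j))

module D = Scan dumontCell?
module E = Scan evenOddDropCell?

-- Odd positions must rise, and even ones accept any smaller value whatever its parity; so `ε` is 1
-- at every Dumont step.
dumontCell-fall : ∀ i k → k < i → 𝟙 (dumontCell? i k) ≡ 1 * 𝟙 (2 ∣? suc i)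
dumontCell-fall i k k<i = ≡.trans
  (𝟙-⇔ (dumontCell? i k) (2 ∣? suc i) (mk⇔
    (λ d → decidable-stable (2 ∣? suc i) λ 2∤1+i → <-asym k<i (proj₂ d 2∤1+i))
    (λ 2∣1+i → (λ _ → k<i) , contradiction 2∣1+i)))
  (sym (*-identityˡ _))

-- The position must rise, hence waits; the value fills one of `h` waiting positions or waits too.
D-odd : ∀ {k} → 2 ∣ k → ∀ n h → D.W k (suc n) h ≡ h * D.W (suc k) n h + D.W (suc k) n (suc h)
D-odd {k} 2∣k n h = ≡.trans
  (D.W-step 1 1 (𝟙-false (2 ∣? suc k) odd)
                (𝟙-false (dumontCell? k k) λ d → <-irrefl refl (proj₂ d odd))
                (λ j k<j → 𝟙-true (dumontCell? k j) ((λ even → contradiction even odd) , λ _ → k<j))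
                (λ i → dumontCell-fall i k) n h)
  (simplify h (V (pred h)) (V h) (V (suc h)))
  where
  V = D.W (suc k) n
  odd = 2∣n⇒2∤1+n 2∣k
  simplify : ∀ h x y z →
    h * (0 * (h * x) + 1 * y) + 0 * y + 1 * (0 * (h * y) + 1 * z) ≡ h * y + z
  simplify = solve-∀

-- The position must drop to one of `h` unmatched values; the value is free as before.
D-even : ∀ {k} → 2 ∣ suc k → ∀ n h →
         D.W k (suc n) h ≡ h * h * D.W (suc k) n (pred h) + h * D.W (suc k) n h
D-even {k} even n h = ≡.trans
  (D.W-step 0 1 (𝟙-true (2 ∣? suc k) even)
                (𝟙-false (dumontCell? k k) λ d → <-irrefl refl (proj₁ d even))
                (λ j k<j → 𝟙-false (dumontCell? k j) λ d → <-asym k<j (proj₁ d even))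
                (λ i → dumontCell-fall i k) n h)
  (simplify h (V (pred h)) (V h) (V (suc h)))
  where
  V = D.W (suc k) n
  simplify : ∀ h x y z →
    h * (1 * (h * x) + 0 * y) + 0 * y + 1 * (1 * (h * y) + 0 * z) ≡ h * h * x + h * y
  simplify = solve-∀

evenOddDropCell-≤ : ∀ i j → i ≤ j → 𝟙 (evenOddDropCell? i j) ≡ 1
evenOddDropCell-≤ i j i≤j =
  𝟙-true (evenOddDropCell? i j) λ j<i → contradiction j<i (≤⇒≯ i≤j)

-- The position cannot drop, but it may be fixed, which turns the Dumont weight `h` into `h + 1`.
E-odd : ∀ {k} → 2 ∣ k → ∀ n h →
        E.W k (suc n) h ≡ suc h * E.W (suc k) n h + E.W (suc k) n (suc h)
E-odd {k} 2∣k n h = ≡.trans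
  (E.W-step 1 1 (𝟙-false (2 ∣? suc k) odd) (evenOddDropCell-≤ k k ≤-refl)
                (λ j k<j → evenOddDropCell-≤ k j (<⇒≤ k<j)) fall n h)
  (simplify h (V (pred h)) (V h) (V (suc h)))
  where
  V = E.W (suc k) n
  odd = 2∣n⇒2∤1+n 2∣k
  fall : ∀ i → k < i → 𝟙 (evenOddDropCell? i k) ≡ 1 * 𝟙 (2 ∣? suc i)
  fall i k<i = ≡.trans
    (𝟙-⇔ (evenOddDropCell? i k) (2 ∣? suc i) (mk⇔ (λ e → proj₁ (e k<i)) (λ 2∣1+i _ → 2∣1+i , odd)))
    (sym (*-identityˡ _))
  simplify : ∀ h x y z →
    h * (0 * (h * x) + 1 * y) + 1 * y + 1 * (0 * (h * y) + 1 * z) ≡ (1 + h) * y + z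
  simplify = solve-∀

-- No later position may drop to an even value, so the value is fixed or fills one of `h` waiting
-- positions; in the latter case the position drops or waits.
E-even : ∀ {k} → 2 ∣ suc k → ∀ n h →
         E.W k (suc n) h ≡ h * h * E.W (suc k) n (pred h) + suc h * E.W (suc k) n h
E-even {k} even n h = ≡.trans
  (E.W-step 1 0 (𝟙-true (2 ∣? suc k) even) (evenOddDropCell-≤ k k ≤-refl)
                (λ j k<j → evenOddDropCell-≤ k j (<⇒≤ k<j))
                (λ i k<i → 𝟙-false (evenOddDropCell? i k) λ e → proj₂ (e k<i) even) n h)
  (simplify h (V (pred h)) (V h) (V (suc h)))
  where
  V = E.W (suc k) n
  simplify : ∀ h x y z →
    h * (1 * (h * x) + 1 * y) + 1 * y + 0 * (1 * (h * y) + 1 * z) ≡ h * h * x + (1 + h) * y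
  simplify = solve-∀

-- Comparison of the two scans

D-E : ∀ n {k} l h → 2 ∣ k → 2 ∣ l → D.W (suc k) (suc (n * 2)) (suc h) ≡ suc h * E.W l (n * 2) h
D-E zero {k} l zero 2∣k 2∣l = begin
  -- A single even step reaches height 0 only from height 1.
  D.W (suc k) 1 1                                  ≡⟨ D-even (2∣n⇒2∣2+n 2∣k) 0 1 ⟩
  1 * 1 * D.W (2 + k) 0 0 + 1 * D.W (2 + k) 0 1    ≡⟨⟩
  1 * E.W l 0 0 ∎
D-E zero {k} l (suc h) 2∣k 2∣l = begin
  D.W (suc k) 1 (2 + h)
    ≡⟨ D-even (2∣n⇒2∣2+n 2∣k) 0 (2 + h) ⟩
  (2 + h) * (2 + h) * D.W (2 + k) 0 (1 + h) + (2 + h) * D.W (2 + k) 0 (2 + h)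
    ≡⟨ cong₂ (λ x y → (2 + h) * (2 + h) * x + (2 + h) * y)
         (D.W-unmatched (2 + k) h) (D.W-unmatched (2 + k) (suc h)) ⟩
  (2 + h) * (2 + h) * 0 + (2 + h) * 0
    ≡⟨ simplify h ⟩
  (2 + h) * 0
    ≡⟨ cong ((2 + h) *_) (E.W-unmatched l h) ⟨
  (2 + h) * E.W l 0 (suc h) ∎
  where
  simplify : ∀ h → (2 + h) * (2 + h) * 0 + (2 + h) * 0 ≡ (2 + h) * 0
  simplify = solve-∀
D-E (suc n) {k} l h 2∣k 2∣l = begin
  D.W (suc k) (suc (suc n * 2)) (suc h)
    ≡⟨ D-even (2∣n⇒2∣2+n 2∣k) (suc n * 2) (suc h) ⟩
  suc h * suc h * D.W (2 + k) (suc n * 2) h + suc h * D.W (2 + k) (suc n * 2) (suc h)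
    ≡⟨ cong₂ (λ x y → suc h * suc h * x + suc h * y)
         (D-odd (2∣n⇒2∣2+n 2∣k) (suc (n * 2)) h) (D-odd (2∣n⇒2∣2+n 2∣k) (suc (n * 2)) (suc h)) ⟩
  suc h * suc h * (h * X h + X (suc h)) + suc h * (suc h * X (suc h) + X (2 + h))
    ≡⟨ cong₂ (λ x y → suc h * suc h * (x + y) + suc h * (suc h * y + X (2 + h)))
         (h*X h) (X-suc h) ⟩
  suc h * suc h * (h * h * Y (pred h) + suc h * Y h) + suc h * (suc h * (suc h * Y h) + X (2 + h))
    ≡⟨ cong (λ z → suc h * suc h * (h * h * Y (pred h) + suc h * Y h) +
                   suc h * (suc h * (suc h * Y h) + z)) (X-suc (suc h)) ⟩
  suc h * suc h * (h * h * Y (pred h) + suc h * Y h) +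
  suc h * (suc h * (suc h * Y h) + (2 + h) * Y (suc h))
    ≡⟨ rearrange h (Y (pred h)) (Y h) (Y (suc h)) ⟩
  suc h * (suc h * (h * h * Y (pred h) + suc h * Y h) +
           (suc h * suc h * Y h + (2 + h) * Y (suc h)))
    ≡⟨ cong₂ (λ x y → suc h * (suc h * x + y))
         (E-even (2∣n⇒2∣2+n 2∣l) (n * 2) h) (E-even (2∣n⇒2∣2+n 2∣l) (n * 2) (suc h)) ⟨
  suc h * (suc h * E.W (suc l) (suc (n * 2)) h + E.W (suc l) (suc (n * 2)) (suc h))
    ≡⟨ cong (suc h *_) (E-odd 2∣l (suc (n * 2)) h) ⟨
  suc h * E.W l (suc n * 2) h ∎
  where
  X = D.W (3 + k) (suc (n * 2))
  Y = E.W (2 + l) (n * 2)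
  X-suc : ∀ h → X (suc h) ≡ suc h * Y h
  X-suc h = D-E n (2 + l) h (2∣n⇒2∣2+n 2∣k) (2∣n⇒2∣2+n 2∣l)
  h*X : ∀ h → h * X h ≡ h * h * Y (pred h)
  -- The induction hypothesis covers only positive heights of `X`; at height 0 the factor `h`
  -- suffices.
  h*X zero    = refl
  h*X (suc h) = ≡.trans (cong (suc h *_) (X-suc h)) (sym (*-assoc (suc h) (suc h) (Y h)))
  rearrange : ∀ h x y z →
    (1 + h) * (1 + h) * (h * h * x + (1 + h) * y) +
    (1 + h) * ((1 + h) * ((1 + h) * y) + (2 + h) * z) ≡
    (1 + h) * ((1 + h) * (h * h * x + (1 + h) * y) + ((1 + h) * (1 + h) * y + (2 + h) * z))
  rearrange = solve-∀

-- From permutations to matrix entries, and the conclusion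

isDumontDerangement⇔ : ∀ {m} (σ : Permutation′ (m * 2)) →
  IsDumontDerangement {m} σ ⇔ (∀ i → DumontCell (toℕ i) (toℕ (σ ⟨$⟩ʳ i)))
isDumontDerangement⇔ {m} σ = mk⇔ to from
  where
  2∣value-⟨2i⟩ : (i : Fin m) → 2 ∣ value ⟨2 i ⟩
  2∣value-⟨2i⟩ i = subst (2 ∣_) (sym (value-⟨2i⟩ i)) (m∣m*n (value i))

  2∤value-⟨2i-1⟩ : (i : Fin m) → 2 ∤ value ⟨2 i -1⟩
  2∤value-⟨2i-1⟩ i = 2∣n⇒2∤1+n
    (subst (2 ∣_) (sym (≡.trans (toℕ-combine i 0F) (+-identityʳ _))) (m∣m*n (toℕ i)))

  to : IsDumontDerangement {m} σ → ∀ i → DumontCell (toℕ i) (toℕ (σ ⟨$⟩ʳ i))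
  -- Every index is `⟨2 j -1⟩` or `⟨2 j ⟩`, so one implication is vacuous and `d j` gives the other.
  to d i with combine-surjective {m} {2} i
  ... | j , 0F , refl = (λ even → contradiction even (2∤value-⟨2i-1⟩ j)) , λ _ → proj₂ (d j)
  ... | j , 1F , refl = (λ _ → proj₁ (d j)) , contradiction (2∣value-⟨2i⟩ j)

  from : (∀ i → DumontCell (toℕ i) (toℕ (σ ⟨$⟩ʳ i))) → IsDumontDerangement {m} σ
  from c i = proj₁ (c ⟨2 i ⟩) (2∣value-⟨2i⟩ i) , proj₂ (c ⟨2 i -1⟩) (2∤value-⟨2i-1⟩ i)

corollary6p2 : (n : ℕ) → n ≥ 1 → medianGenocchi n ≡ count (hasOnlyEvenOddDrops? {n * 2})
corollary6p2 n _ = begin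
  medianGenocchi n
    ≡⟨ D.count-W (isDumontDerangement? {suc n}) isDumontDerangement⇔ ⟩
  D.W 0 (suc n * 2) 0
    -- At height 0 the summand of weight `h` vanishes by computation.
    ≡⟨ D-odd (2 ∣0) (suc (n * 2)) 0 ⟩
  D.W 1 (suc (n * 2)) 1
    ≡⟨ D-E n 0 0 (2 ∣0) (2 ∣0) ⟩
  1 * E.W 0 (n * 2) 0
    ≡⟨ *-identityˡ _ ⟩
  E.W 0 (n * 2) 0
    -- The predicate unfolds to `EvenOddDropCell` at every position.
    ≡⟨ E.count-W (hasOnlyEvenOddDrops? {n * 2}) (λ σ → mk⇔ id id) ⟨
  count (hasOnlyEvenOddDrops? {n * 2}) ∎
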